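{- The chromatic number of any triangle-free graph $G=(V,E)$ with local boxicity at most two is at most $18$.
   Context: All graphs are finite and simple. A real interval is either a bounded interval of $\mathbb{R}$ or $\mathbb{R}$ itself. For an integer $d'\ge 1$, a $d'$-box is a Cartesian product $I_1\times\cdots\times I_{d'}$ of real intervals; it is local in dimension $i$ if $I_i$ is bounded. A $d$-local box in dimension $d'\ge d$ is a $d'$-box that is local in at most $d$ dimensions. The local boxicity $\mathrm{lbox}(G)$ of a graph $G$ is the minimum integer $d$ such that, for some $d'$, there are $d$-local boxes $(B_v)_{v\in V(G)}$ in dimension $d'$ such that two distinct vertices $u,v$ are adjacent in $G$ if and only if $B_u\cap B_v\neq\emptyset$. -}

module Defs where

open import Level using (0ℓ)
open import Data.Nat using (ℕ; _≤_)
open import Data.Fin using (Fin)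
open import Data.Bool using (Bool; true; false)
open import Data.Product using (Σ; ∃; _×_; _,_)
open import Data.Sum using (_⊎_)
open import Data.Empty using (⊥)
open import Relation.Nullary using (¬_)
open import Relation.Binary.PropositionalEquality using (_≡_; _≢_)
open import Relation.Binary.Core using (Rel)
open import Relation.Binary.Structures using (IsStrictTotalOrder)
open import Algebra.Structures using (IsCommutativeRing)
open import Function.Bundles using (_⇔_)

-- The real line: agda-stdlib has no reals, so we quantify over any
-- model of the axioms of ℝ (a Dedekind-complete ordered field; unique
-- up to isomorphism, so this is faithful).

record RealLine : Set₁ where
  infixl 6 _+_
  infixl 7 _*_
  infix 4 _<_ _≤ᵣ_
  field
    ℝ   : Set
    _<_ : Rel ℝ 0ℓ
    isStrictTotalOrder : IsStrictTotalOrder _≡_ _<_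
    0# 1# : ℝ
    _+_ _*_ : ℝ → ℝ → ℝ
    -_ : ℝ → ℝ
    isCommutativeRing : IsCommutativeRing _≡_ _+_ _*_ -_ 0# 1#
    0≢1 : 0# ≢ 1#
    inverse : ∀ x → x ≢ 0# → ∃ λ y → x * y ≡ 1#
    +-mono-< : ∀ x y z → x < y → x + z < y + z
    *-pos : ∀ x y → 0# < x → 0# < y → 0# < x * y

  _≤ᵣ_ : ℝ → ℝ → Set
  x ≤ᵣ y = ¬ (y < x)

  field
    complete : (P : ℝ → Set) → (∃ λ x → P x) → (∃ λ b → ∀ x → P x → x ≤ᵣ b) →
               ∃ λ s → (∀ x → P x → x ≤ᵣ s) × (∀ b → (∀ x → P x → x ≤ᵣ b) → s ≤ᵣ b)

module _ (R : RealLine) where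
  open RealLine R

  -- an endpoint: a value together with a flag "closed at this end"
  Endpoint : Set
  Endpoint = ℝ × Bool

  -- a real interval: either ℝ itself, or a bounded interval given by its
  -- two endpoints (open/closed at each end; empty intervals allowed)
  data Interval : Set where
    whole   : Interval
    bounded : Endpoint → Endpoint → Interval

  above : Endpoint → ℝ → Set
  above (a , true)  x = a ≤ᵣ x
  above (a , false) x = a < x

  below : Endpoint → ℝ → Set
  below (b , true)  x = x ≤ᵣ b
  below (b , false) x = x < b

  _∈I_ : ℝ → Interval → Set
  x ∈I whole = ⊤'
    where open import Data.Unit using () renaming (⊤ to ⊤')
  x ∈I bounded lo hi = above lo x × below hi x

  isLocal : Interval → Bool
  isLocal whole = false
  isLocal (bounded _ _) = true

  Box : ℕ → Set
  Box d' = Fin d' → Interval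

  localCount : ∀ {d'} → Box d' → ℕ
  localCount {d'} B = count (λ i → isLocal (B i))
    where
    open import Data.Nat using (zero; suc)
    open import Data.Fin using (zero; suc)
    count : ∀ {m} → (Fin m → Bool) → ℕ
    count {zero} f = zero
    count {suc m} f with f zero
    ... | true  = suc (count (λ i → f (suc i)))
    ... | false = count (λ i → f (suc i))

  boxesIntersect : ∀ {d'} → Box d' → Box d' → Set
  boxesIntersect {d'} B C = ∃ λ (x : Fin d' → ℝ) → ∀ i → (x i ∈I B i) × (x i ∈I C i)

record Graph (n : ℕ) : Set₁ where
  field
    Adj  : Fin n → Fin n → Set
    sym  : ∀ {u v} → Adj u v → Adj v u
    irrefl : ∀ {u} → ¬ Adj u u

open Graph public

TriangleFree : ∀ {n} → Graph n → Set
TriangleFree G = ∀ a b c → ¬ (Adj G a b × Adj G b c × Adj G a c)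

Colourable : ∀ {n} → Graph n → ℕ → Set
Colourable {n} G k = ∃ λ (c : Fin n → Fin k) → ∀ u v → Adj G u v → c u ≢ c v

HasLocalBoxRep : ∀ {n} → RealLine → Graph n → ℕ → Set
HasLocalBoxRep {n} R G d =
  ∃ λ (d' : ℕ) → (1 ≤ d') × (d ≤ d') × ∃ λ (B : Fin n → Box R d') →
    (∀ v → localCount R (B v) ≤ d) ×
    (∀ u v → u ≢ v → (Adj G u v ⇔ boxesIntersect R (B u) (B v)))

LboxAtMost : ∀ {n} → RealLine → Graph n → ℕ → Set
LboxAtMost R G k = ∃ λ d → (d ≤ k) × HasLocalBoxRep R G d

{-# OPTIONS --safe #-}

-- After padding, every vertex v has two dimensions a v ≤ b v outside of which its box is unbounded.
-- Call two vertices crossing if each is strictly inside the other in some dimension.  Among adjacent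
-- non-crossing vertices with the same two dimensions, triangle-freeness lets each of the four corners
-- of a box lie in at most one other box, while every edge uses at least two corners; so this graph is
-- 4-degenerate and 5-colourable, and it remains to separate the other edges.
--
-- Vertices with disjoint dimensions are adjacent.  If some such pair A, B exists, the vertices having a
-- disjoint partner are coloured with 6 colours: one for each of the neighbourhoods of A and B, and one
-- for each of the at most four pairs of dimensions meeting those of A and of B (such a class has a
-- common neighbour).  The dimension pairs of the other vertices pairwise intersect, hence form a star
-- or a triangle, and a triangle cannot meet both A and B.
--
-- A vertex u that is strictly inside (thin in) dimension i of a neighbour with the same dimensions has
-- no neighbour that shares with it the dimension i only.  In a star with centre e, the intervals in
-- direction e form a forest of classes, and its 2-colouring is flipped at the vertices thin in e: 2 · 5
-- colours.  In a triangle a cyclic rule takes 3 · 5 colours.  In total max (6 + 10, 15) ≤ 18.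
module Submission where

open import Defs hiding (sym)
open import Level using (0ℓ)
open import Algebra.Bundles using (CommutativeRing)
import Algebra.Properties.Ring
open import Data.Bool using (Bool; true; false; not; _xor_; f<t; if_then_else_)
import Data.Bool.Properties as Boolₚ
open Boolₚ using (not-¬; ¬-not)
open import Data.Empty using (⊥; ⊥-elim)
open import Data.Fin as Fin using (Fin; zero; suc; punchIn; punchOut)
import Data.Fin.Properties as Finₚ
open import Data.Nat using (ℕ; zero; suc; _+_; _*_; _≤_; _<_; z≤n; s≤s)
import Data.Nat.Properties as ℕₚ
open import Data.Nat.Tactic.RingSolver using (solve-∀)
open import Data.Product using (∃; ∃₂; _×_; _,_; proj₁; proj₂; swap)
open import Data.Product.Relation.Binary.Lex.Strict using (×-strictTotalOrder)
open import Data.Sum as Sum using (_⊎_; inj₁; inj₂; [_,_]′)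
open import Data.Unit using (⊤; tt)
open import Data.Vec.Functional using (Vector; insertAt)
open import Data.Vec.Functional.Properties using (insertAt-lookup; insertAt-punchIn)
open import Function using (_∘_)
open import Function.Bundles using (_⇔_; Equivalence)
open import Relation.Nullary using (¬_; Dec; yes; no; contradiction)
open import Relation.Nullary.Construct.Add.Extrema using (⊥±; ⊤±; [_])
open import Relation.Nullary.Decidable using (_×-dec_; _⊎-dec_; ¬?; decidable-stable; does; dec-true; dec-false)
import Relation.Binary as B
open import Relation.Binary.Bundles using (StrictTotalOrder)
import Relation.Binary.Construct.Add.Extrema.Strict as Extrema
open import Relation.Binary.PropositionalEquality hiding ([_])
import Relation.Unary as U
open import Algebra.Properties.CommutativeMonoid.Sum ℕₚ.+-0-commutativeMonoid
  using (sum; sum-remove; sum-cong-≗; ∑-comm; ∑-distrib-+)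

-- Colouring graphs by inserting one vertex at a time

ind : {P : Set} → Dec P → ℕ
ind (yes _) = 1
ind (no _)  = 0

ind-yes : {P : Set} (P? : Dec P) → P → ind P? ≡ 1
ind-yes (yes _) p = refl
ind-yes (no ¬p) p = contradiction p ¬p

ind-no : {P : Set} (P? : Dec P) → ¬ P → ind P? ≡ 0
ind-no (yes p) ¬p = contradiction p ¬p
ind-no (no _)  ¬p = refl

sum-mono : ∀ {n} {f g : Vector ℕ n} → (∀ i → f i ≤ g i) → sum f ≤ sum g
sum-mono {zero}  f≤g = z≤n
sum-mono {suc n} f≤g = ℕₚ.+-mono-≤ (f≤g zero) (sum-mono (f≤g ∘ suc))

sum-upper : ∀ {n k} {f : Vector ℕ n} → (∀ i → f i ≤ k) → sum f ≤ n * k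
sum-upper {zero}  f≤k = z≤n
sum-upper {suc n} f≤k = ℕₚ.+-mono-≤ (f≤k zero) (sum-upper (f≤k ∘ suc))

sum-lower : ∀ {n k} {f : Vector ℕ n} → (∀ i → k ≤ f i) → n * k ≤ sum f
sum-lower {zero}  k≤f = z≤n
sum-lower {suc n} k≤f = ℕₚ.+-mono-≤ (k≤f zero) (sum-lower (k≤f ∘ suc))

sum-ind≤1 : ∀ {n} {P : Fin n → Set} (P? : U.Decidable P) →
  (∀ i j → P i → P j → i ≡ j) → sum (ind ∘ P?) ≤ 1
sum-ind≤1 {zero}  P? unique = z≤n
sum-ind≤1 {suc n} P? unique with P? zero
... | no _  = sum-ind≤1 (P? ∘ suc) (λ i j p q → Finₚ.suc-injective (unique _ _ p q))
... | yes p = s≤s (subst (sum (ind ∘ P? ∘ suc) ≤_) (ℕₚ.*-zeroʳ n) (sum-upper λ i →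
  ℕₚ.≤-reflexive (ind-no (P? (suc i)) λ q → Finₚ.0≢1+n (unique _ _ p q))))

1≤sum-ind : ∀ {n} {P : Fin n → Set} (P? : U.Decidable P) {i} → P i → 1 ≤ sum (ind ∘ P?)
1≤sum-ind {suc n} P? {i} p = subst (1 ≤_) (sym (sum-remove {i = i} (ind ∘ P?)))
  (ℕₚ.≤-trans (ℕₚ.≤-reflexive (sym (ind-yes (P? i) p))) (ℕₚ.m≤m+n _ _))

-- Double counting of pairs of an element of `P` and its colour: if all `suc k` colours occurred
-- there would be at least `suc k` pairs, whereas each element of `P` contributes only one.
free-colour : ∀ {n k} {P : Fin n → Set} (P? : U.Decidable P) (c : Fin n → Fin (suc k)) →
  sum (ind ∘ P?) ≤ k → ∃ λ x → ∀ i → P i → c i ≢ x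
free-colour {n} {k} {P} P? c few
  with Finₚ.any? (λ x → ¬? (Finₚ.any? (λ i → P? i ×-dec (c i Finₚ.≟ x))))
... | yes (x , unused) = x , λ i p eq → unused (i , p , eq)
... | no allUsed = contradiction few (ℕₚ.<⇒≱ (begin-strict
    k                                       <⟨ ℕₚ.n<1+n k ⟩
    suc k                                   ≡⟨ sym (ℕₚ.*-identityʳ (suc k)) ⟩
    suc k * 1                               ≤⟨ sum-lower (λ x → 1≤sum-ind (λ i → hit? i x) (proj₂ (used x))) ⟩
    sum (λ x → sum (λ i → ind (hit? i x)))  ≡⟨ ∑-comm (λ x i → ind (hit? i x)) ⟩
    sum (λ i → sum (λ x → ind (hit? i x)))  ≤⟨ sum-mono single ⟩
    sum (ind ∘ P?)                          ∎))
  where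
  open ℕₚ.≤-Reasoning
  hit? : ∀ i x → Dec (P i × c i ≡ x)
  hit? i x = P? i ×-dec (c i Finₚ.≟ x)
  used : ∀ x → ∃ λ i → P i × c i ≡ x
  used x with Finₚ.any? (λ i → hit? i x)
  ... | yes h  = h
  ... | no ¬h = contradiction (x , ¬h) allUsed
  single : ∀ i → sum (λ x → ind (hit? i x)) ≤ ind (P? i)
  single i with P? i in eq
  ... | yes p = sum-ind≤1 (λ x → yes p ×-dec (c i Finₚ.≟ x)) λ { x y (_ , q) (_ , r) → trans (sym q) r }
  ... | no ¬p = subst (sum {suc k} (λ x → ind (no ¬p ×-dec (c i Finₚ.≟ x))) ≤_) (ℕₚ.*-zeroʳ (suc k))
          (sum-upper λ x → ℕₚ.≤-reflexive (ind-no (no ¬p ×-dec (c i Finₚ.≟ x)) (¬p ∘ proj₁)))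

-- An averaging argument. With `W` the total weight and `D` the sum of degrees, the edge condition
-- gives `D + D ≤ W + W`, whereas degrees all above `k` would force `W < D`.
small-degree : ∀ {m k} {E : Fin (suc m) → Fin (suc m) → Set} (E? : B.Decidable E) (w : Fin (suc m) → Fin (suc m) → ℕ) →
  (∀ u → sum (w u) ≤ k) → (∀ u v → E u v → 2 ≤ w u v + w v u) → ∃ λ u → sum (ind ∘ E? u) ≤ k
small-degree {m} {k} {E} E? w row heavy with Finₚ.any? (λ u → sum (ind ∘ E? u) ℕₚ.≤? k)
... | yes h = h
... | no allLarge = contradiction double (ℕₚ.<⇒≱ (ℕₚ.+-mono-< W<D W<D))
  where
  open ℕₚ.≤-Reasoning
  W D : ℕ
  W = sum (λ u → sum (w u))
  D = sum (λ u → sum (ind ∘ E? u))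
  W<D : W < D
  W<D = begin-strict
    W                  ≤⟨ sum-upper row ⟩
    suc m * k          <⟨ ℕₚ.*-monoʳ-< (suc m) (ℕₚ.n<1+n k) ⟩
    suc m * suc k      ≤⟨ sum-lower (λ u → ℕₚ.≰⇒> (λ h → allLarge (u , h))) ⟩
    D                  ∎
  entry : ∀ u v → ind (E? u v) + ind (E? u v) ≤ w u v + w v u
  entry u v with E? u v
  ... | yes e = heavy u v e
  ... | no _  = z≤n
  ∑∑-distrib : ∀ (f g : Fin (suc m) → Fin (suc m) → ℕ) →
    sum (λ u → sum (λ v → f u v + g u v)) ≡ sum (λ u → sum (f u)) + sum (λ u → sum (g u))
  ∑∑-distrib f g = trans (sum-cong-≗ (λ u → ∑-distrib-+ (f u) (g u))) (∑-distrib-+ (λ u → sum (f u)) (λ u → sum (g u)))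
  double : D + D ≤ W + W
  double = begin
    D + D                                                ≡⟨ sym (∑∑-distrib (λ u v → ind (E? u v)) (λ u v → ind (E? u v))) ⟩
    sum (λ u → sum (λ v → ind (E? u v) + ind (E? u v)))  ≤⟨ sum-mono (λ u → sum-mono (entry u)) ⟩
    sum (λ u → sum (λ v → w u v + w v u))       ≡⟨ ∑∑-distrib w (λ u v → w v u) ⟩
    W + sum (λ u → sum (λ v → w v u))           ≡⟨ cong (W +_) (∑-comm (λ u v → w v u)) ⟩
    W + W                                       ∎

data View {n} (v : Fin (suc n)) : Fin (suc n) → Set where
  here  : View v v
  there : ∀ j → View v (punchIn v j)

view : ∀ {n} (v u : Fin (suc n)) → View v u
view v u with v Finₚ.≟ u
... | yes refl = here
... | no v≢u = subst (View v) (Finₚ.punchIn-punchOut v≢u) (there (punchOut v≢u))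

insert-colouring : ∀ {n} {C : Set} {E : Fin (suc n) → Fin (suc n) → Set} → B.Symmetric E → (∀ {u} → ¬ E u u) →
  (v : Fin (suc n)) (c : Fin n → C) (x : C) →
  (∀ i j → E (punchIn v i) (punchIn v j) → c i ≢ c j) → (∀ i → E v (punchIn v i) → c i ≢ x) →
  ∀ a b → E a b → insertAt c v x a ≢ insertAt c v x b
insert-colouring E-sym E-irr v c x old new a b e eq with view v a | view v b
... | here    | here    = E-irr e
... | here    | there j rewrite insertAt-lookup c v x | insertAt-punchIn c v x j = new j e (sym eq)
... | there i | here    rewrite insertAt-lookup c v x | insertAt-punchIn c v x i = new i (E-sym e) eq
... | there i | there j rewrite insertAt-punchIn c v x i | insertAt-punchIn c v x j = old i j e eq

sum-punchIn≤ : ∀ {n} (v : Fin (suc n)) (f : Fin (suc n) → ℕ) → sum (f ∘ punchIn v) ≤ sum f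
sum-punchIn≤ v f = subst (sum (f ∘ punchIn v) ≤_) (sym (sum-remove {i = v} f)) (ℕₚ.m≤n+m _ _)

-- Summing the weights bounds the average degree by 2k/2 = k in every induced subgraph.
weighted-degeneracy-colouring : ∀ {k} n {E : Fin n → Fin n → Set} (E? : B.Decidable E) → B.Symmetric E → (∀ {u} → ¬ E u u) →
  (w : Fin n → Fin n → ℕ) → (∀ u → sum (w u) ≤ k) → (∀ u v → E u v → 2 ≤ w u v + w v u) →
  ∃ λ (c : Fin n → Fin (suc k)) → ∀ u v → E u v → c u ≢ c v
weighted-degeneracy-colouring zero E? E-sym E-irr w row heavy = (λ ()) , λ ()
weighted-degeneracy-colouring {k} (suc n) {E} E? E-sym E-irr w row heavy
  with v , deg≤k ← small-degree E? w row heavy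
  with c , proper ← weighted-degeneracy-colouring n (λ i j → E? (punchIn v i) (punchIn v j)) E-sym E-irr
         (λ i j → w (punchIn v i) (punchIn v j))
         (λ i → ℕₚ.≤-trans (sum-punchIn≤ v (w (punchIn v i))) (row (punchIn v i)))
         (λ i j → heavy (punchIn v i) (punchIn v j))
  with x , free ← free-colour (λ i → E? v (punchIn v i)) c (ℕₚ.≤-trans (sum-punchIn≤ v (ind ∘ E? v)) deg≤k)
  = insertAt c v x , insert-colouring E-sym E-irr v c x proper free

maximum : ∀ {m} {_≼_ : Fin (suc m) → Fin (suc m) → Set} → B.Total _≼_ → B.Transitive _≼_ → ∃ λ v → ∀ u → u ≼ v
maximum {zero} total ≼-trans = zero , λ { zero → Sum.reduce (total zero zero) }
maximum {suc m} {_≼_} total ≼-trans with maximum {m} {λ i j → suc i ≼ suc j} (λ i j → total (suc i) (suc j)) ≼-trans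
... | v , max with total zero (suc v)
...   | inj₁ 0≼v = suc v , λ { zero → 0≼v ; (suc u) → max u }
...   | inj₂ v≼0 = zero , λ { zero → Sum.reduce (total zero zero) ; (suc u) → ≼-trans (max u) v≼0 }

-- The order makes _~_ chordal.  Contracting each connected piece of a class of κ leaves a forest,
-- whose 2-colouring is built by inserting the ≼-largest vertex last.
chordal-2-colouring : ∀ m {K : Set} → B.DecidableEquality K → (κ : Fin m → K) →
  {_~_ _≼_ : Fin m → Fin m → Set} → B.Decidable _~_ → B.Symmetric _~_ → B.Total _≼_ → B.Transitive _≼_ →
  (∀ {u u′ v} → u ~ v → u′ ~ v → u ≼ v → u′ ≼ v → u ~ u′) →
  (∀ {u v w} → u ~ v → v ~ w → u ~ w → κ u ≢ κ v → κ v ≢ κ w → κ u ≢ κ w → ⊥) →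
  ∃ λ (p : Fin m → Bool) → ∀ u v → u ~ v → (κ u ≡ κ v → p u ≡ p v) × (κ u ≢ κ v → p u ≢ p v)
chordal-2-colouring zero _≟_ κ ~? ~-sym total ≼-trans elim thin = (λ ()) , λ ()
chordal-2-colouring (suc m) _≟_ κ {_~_} {_≼_} ~? ~-sym total ≼-trans elim thin
  with v , max ← maximum total ≼-trans
  with p , p-ok ← chordal-2-colouring m _≟_ (κ ∘ punchIn v)
         {λ i j → punchIn v i ~ punchIn v j} {λ i j → punchIn v i ≼ punchIn v j}
         (λ i j → ~? (punchIn v i) (punchIn v j)) ~-sym
         (λ i j → total (punchIn v i) (punchIn v j)) ≼-trans elim thin
  = insertAt p v new , ok
  where
  new : Bool
  new with Finₚ.any? (λ i → ~? (punchIn v i) v)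
  ... | no _ = false
  ... | yes (i , _) with κ (punchIn v i) ≟ κ v
  ...   | yes _ = p i
  ...   | no _  = not (p i)
  Compatible : Fin (suc m) → Bool → Fin (suc m) → Bool → Set
  Compatible x px y py = (κ x ≡ κ y → px ≡ py) × (κ x ≢ κ y → px ≢ py)
  flip : ∀ {x px y py} → Compatible x px y py → Compatible y py x px
  flip (eq , ne) = (λ h → sym (eq (sym h))) , (λ h → ne (h ∘ sym) ∘ sym)
  -- One neighbour `i` of `v` fixes the new bit. Any other neighbour `j` is related to `i` because
  -- `v` is largest, so the bits of `i` and `j` are already compatible.
  new-ok : ∀ j → punchIn v j ~ v → Compatible (punchIn v j) (p j) v new
  new-ok j j~v with Finₚ.any? (λ i → ~? (punchIn v i) v)
  ... | no none = contradiction (j , j~v) none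
  ... | yes (i , i~v) with κ (punchIn v i) ≟ κ v | p-ok j i (elim j~v i~v (max _) (max _))
  ...   | yes i≡v | eq , ne = (λ j≡v → eq (trans j≡v (sym i≡v))) , (λ j≢v → ne (λ j≡i → j≢v (trans j≡i i≡v)))
  ...   | no i≢v  | eq , ne = (λ j≡v → ¬-not (ne (λ j≡i → i≢v (trans (sym j≡i) j≡v)))) , different
    where
    different : κ (punchIn v j) ≢ κ v → p j ≢ not (p i)
    different j≢v with κ (punchIn v j) ≟ κ (punchIn v i)
    ... | yes j≡i = not-¬ (eq j≡i)
    -- The vertices `j`, `i` and `v` would be pairwise related and in three distinct classes.
    ... | no j≢i  = ⊥-elim (thin (elim j~v i~v (max _) (max _)) i~v j~v j≢i i≢v j≢v)
  ok : ∀ x y → x ~ y → Compatible x (insertAt p v new x) y (insertAt p v new y)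
  ok x y x~y with view v x | view v y
  ... | here    | here    = (λ _ → refl) , (λ h → contradiction refl h)
  ... | here    | there j rewrite insertAt-lookup p v new | insertAt-punchIn p v new j = flip (new-ok j (~-sym x~y))
  ... | there i | here    rewrite insertAt-lookup p v new | insertAt-punchIn p v new i = new-ok i x~y
  ... | there i | there j rewrite insertAt-punchIn p v new i | insertAt-punchIn p v new j = p-ok i j x~y

-- Corner counting and small finite case distinctions

ind-× : {P Q : Set} (P? : Dec P) (Q? : Dec Q) → ind (P? ×-dec Q?) ≡ ind P? * ind Q?
ind-× (yes _) (yes _) = refl
ind-× (yes _) (no _)  = refl
ind-× (no _)  _       = refl

ind-≢0 : {P : Set} (P? : Dec P) → P → ind P? ≢ 0
ind-≢0 (yes _) p ()
ind-≢0 (no ¬p) p = contradiction p ¬p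

1≤ind+ind : {P Q : Set} (P? : Dec P) (Q? : Dec Q) → (¬ P → Q) → 1 ≤ ind P? + ind Q?
1≤ind+ind (yes _) Q?      _ = s≤s z≤n
1≤ind+ind (no _)  (yes _) _ = s≤s z≤n
1≤ind+ind (no ¬p) (no ¬q) h = contradiction (h ¬p) ¬q

-- For two boxes with the same two dimensions, `x` and `y` count the ends of the first inside the
-- second in each dimension, and `x′` and `y′` the reverse. The products then count corners, and the
-- two excluded patterns are the crossings.
2≤products : ∀ x y x′ y′ → 2 ≤ x + x′ → 2 ≤ y + y′ → ¬ (x ≡ 0 × y′ ≡ 0) → ¬ (x′ ≡ 0 × y ≡ 0) → 2 ≤ x * y + x′ * y′
2≤products zero _ x′ zero _ _ h _ = contradiction (refl , refl) h
2≤products zero _ x′ (suc y′) 2≤x′ _ _ _ = ℕₚ.≤-trans 2≤x′ (ℕₚ.m≤m*n x′ (suc y′))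
2≤products (suc x) zero zero _ _ _ _ h = contradiction (refl , refl) h
2≤products (suc x) zero (suc x′) y′ _ 2≤y′ _ _ =
  ℕₚ.≤-trans 2≤y′ (ℕₚ.≤-trans (ℕₚ.m≤n*m y′ (suc x′)) (ℕₚ.m≤n+m _ (suc x * zero)))
2≤products (suc x) (suc y) zero y′ 2≤x _ _ _ =
  ℕₚ.≤-trans (subst (2 ≤_) (ℕₚ.+-identityʳ (suc x)) 2≤x) (ℕₚ.≤-trans (ℕₚ.m≤m*n (suc x) (suc y)) (ℕₚ.m≤m+n _ _))
2≤products (suc x) (suc y) (suc x′) zero _ 2≤y _ _ =
  ℕₚ.≤-trans (subst (2 ≤_) (ℕₚ.+-identityʳ (suc y)) 2≤y) (ℕₚ.≤-trans (ℕₚ.m≤n*m (suc y) (suc x)) (ℕₚ.m≤m+n _ _))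
2≤products (suc x) (suc y) (suc x′) (suc y′) _ _ _ _ = ℕₚ.+-mono-≤ (s≤s {n = y + x * suc y} z≤n) (s≤s {n = y′ + x′ * suc y′} z≤n)

two-elements : ∀ {A : Set} {a b x y z : A} → x ≡ a ⊎ x ≡ b → y ≡ a ⊎ y ≡ b → x ≢ y → z ≡ a ⊎ z ≡ b → z ≡ x ⊎ z ≡ y
two-elements (inj₁ refl) (inj₁ refl) x≢y _ = contradiction refl x≢y
two-elements (inj₂ refl) (inj₂ refl) x≢y _ = contradiction refl x≢y
two-elements (inj₁ refl) (inj₂ refl) _ z = z
two-elements (inj₂ refl) (inj₁ refl) _ (inj₁ z) = inj₂ z
two-elements (inj₂ refl) (inj₁ refl) _ (inj₂ z) = inj₁ z

agreement : {P Q : Set} (P? : Dec P) (Q? : Dec Q) → does P? ≡ does Q? → (P × Q) ⊎ (¬ P × ¬ Q)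
agreement (yes p) (yes q) _ = inj₁ (p , q)
agreement (no ¬p) (no ¬q) _ = inj₂ (¬p , ¬q)

nxt : Fin 3 → Fin 3
nxt zero             = suc zero
nxt (suc zero)       = suc (suc zero)
nxt (suc (suc zero)) = zero

nxt-≢ : ∀ k → nxt k ≢ k
nxt-≢ zero ()
nxt-≢ (suc zero) ()
nxt-≢ (suc (suc zero)) ()

nxt²-≢ : ∀ k → nxt (nxt k) ≢ k
nxt²-≢ zero ()
nxt²-≢ (suc zero) ()
nxt²-≢ (suc (suc zero)) ()

nxt³ : ∀ k → nxt (nxt (nxt k)) ≡ k
nxt³ zero             = refl
nxt³ (suc zero)       = refl
nxt³ (suc (suc zero)) = refl

nxt-cases : ∀ k l → l ≡ k ⊎ l ≡ nxt k ⊎ k ≡ nxt l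
nxt-cases zero zero                         = inj₁ refl
nxt-cases zero (suc zero)                   = inj₂ (inj₁ refl)
nxt-cases zero (suc (suc zero))             = inj₂ (inj₂ refl)
nxt-cases (suc zero) zero                   = inj₂ (inj₂ refl)
nxt-cases (suc zero) (suc zero)             = inj₁ refl
nxt-cases (suc zero) (suc (suc zero))       = inj₂ (inj₁ refl)
nxt-cases (suc (suc zero)) zero             = inj₂ (inj₁ refl)
nxt-cases (suc (suc zero)) (suc zero)       = inj₂ (inj₂ refl)
nxt-cases (suc (suc zero)) (suc (suc zero)) = inj₁ refl

-- Boxes whose intervals are pairs of cuts in a linear order

module Intervals (O : StrictTotalOrder 0ℓ 0ℓ 0ℓ) where
  open StrictTotalOrder O public using (module Eq; compare)
    renaming ( Carrier to Cut; _<_ to _≺_; _<?_ to _≺?_; trans to ≺-trans; irrefl to ≺-irrefl; asym to ≺-asym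
             ; <-respˡ-≈ to ≺-respˡ; <-respʳ-≈ to ≺-respʳ)

  ≼-≺-trans : ∀ {x y z} → ¬ (y ≺ x) → y ≺ z → x ≺ z
  ≼-≺-trans {x} {y} y⊀x y≺z with compare x y
  ... | B.tri< x≺y _ _ = ≺-trans x≺y y≺z
  ... | B.tri≈ _ x≈y _ = ≺-respˡ (Eq.sym x≈y) y≺z
  ... | B.tri> _ _ y≺x = contradiction y≺x y⊀x

  ≺-≼-trans : ∀ {x y z} → x ≺ y → ¬ (z ≺ y) → x ≺ z
  ≺-≼-trans {x} {y} {z} x≺y z⊀y with compare y z
  ... | B.tri< y≺z _ _ = ≺-trans x≺y y≺z
  ... | B.tri≈ _ y≈z _ = ≺-respʳ y≈z x≺y
  ... | B.tri> _ _ z≺y = contradiction z≺y z⊀y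

  module Boxes {n d : ℕ} (L R : Fin n → Fin d → Cut) where

    Ov : Fin n → Fin n → Fin d → Set
    Ov u v i = L u i ≺ R v i × L v i ≺ R u i

    Adjacent : Fin n → Fin n → Set
    Adjacent u v = u ≢ v × ∀ i → Ov u v i

    Adjacent? : B.Decidable Adjacent
    Adjacent? u v = ¬? (u Finₚ.≟ v) ×-dec Finₚ.all? (λ i → (L u i ≺? R v i) ×-dec (L v i ≺? R u i))

    Adjacent-sym : ∀ {u v} → Adjacent u v → Adjacent v u
    Adjacent-sym (u≢v , ov) = u≢v ∘ sym , swap ∘ ov

    Inside : Fin n → Fin n → Fin d → Set
    Inside u v i = L v i ≺ L u i × R u i ≺ R v i

    Inside? : ∀ u v i → Dec (Inside u v i)
    Inside? u v i = (L v i ≺? L u i) ×-dec (R u i ≺? R v i)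

    Crossing : Fin n → Fin n → Set
    Crossing u v = ∃ λ i → ∃ λ j → Inside u v i × Inside v u j

    Crossing? : B.Decidable Crossing
    Crossing? u v = Finₚ.any? λ i → Finₚ.any? λ j → Inside? u v i ×-dec Inside? v u j

    Inside-asym : ∀ {u v i} → Inside u v i → ¬ Inside v u i
    Inside-asym (p , _) (q , _) = ≺-asym p q

    ov-inside : ∀ {u v w i} → Inside u v i → Ov u w i → Ov v w i
    ov-inside (p , q) (r , s) = ≺-trans p r , ≺-trans s q

    -- The left end (true) or the right end (false) of u lies in w, provided that u and w overlap.
    Slot : Bool → Fin n → Fin n → Fin d → Set
    Slot true  u w i = ¬ (L u i ≺ L w i)
    Slot false u w i = ¬ (R w i ≺ R u i)

    Slot? : ∀ s u w i → Dec (Slot s u w i)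
    Slot? true  u w i = ¬? (L u i ≺? L w i)
    Slot? false u w i = ¬? (R w i ≺? R u i)

    -- Both intervals contain the part of `u` next to the chosen end.
    slot-ov : ∀ s {u v w i} → Slot s u v i → Slot s u w i → Ov u v i → Ov u w i → Ov v w i
    slot-ov true  p q (r , _) (s , _) = ≼-≺-trans p s , ≼-≺-trans q r
    slot-ov false p q (_ , r) (_ , s) = ≺-≼-trans r q , ≺-≼-trans s p

    ends : Fin n → Fin n → Fin d → ℕ
    ends u w i = ind (Slot? true u w i) + ind (Slot? false u w i)

    ends≡0⇒Inside : ∀ u w i → ends u w i ≡ 0 → Inside w u i
    ends≡0⇒Inside u w i none = ends-fail true (ℕₚ.m+n≡0⇒m≡0 _ none) , ends-fail false (ℕₚ.m+n≡0⇒n≡0 (ind (Slot? true u w i)) none)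
      where
      Fail : Bool → Set
      Fail true  = L u i ≺ L w i
      Fail false = R w i ≺ R u i
      ends-fail : ∀ s → ind (Slot? s u w i) ≡ 0 → Fail s
      ends-fail true  z = decidable-stable (L u i ≺? L w i) λ h → ind-≢0 (Slot? true u w i) h z
      ends-fail false z = decidable-stable (R w i ≺? R u i) λ h → ind-≢0 (Slot? false u w i) h z

    -- The later of the two left ends and the earlier of the two right ends are each counted at
    -- least once.
    2≤ends : ∀ u v i → 2 ≤ ends u v i + ends v u i
    2≤ends u v i = subst (2 ≤_)
      (rearrange (ind (Slot? true u v i)) (ind (Slot? true v u i)) (ind (Slot? false u v i)) (ind (Slot? false v u i)))
      (ℕₚ.+-mono-≤ (1≤ind+ind (Slot? true u v i) (Slot? true v u i) (λ h k → h (λ k′ → ≺-asym k k′)))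
                   (1≤ind+ind (Slot? false u v i) (Slot? false v u i) (λ h k → h (λ k′ → ≺-asym k k′))))
      where
      rearrange : ∀ a b c d → (a + b) + (c + d) ≡ (a + c) + (b + d)
      rearrange = solve-∀

    -- The box of v is unbounded outside of the dimensions a v and b v, which may coincide.
    module Local (a b : Fin n → Fin d) (a≤b : ∀ v → a v Fin.≤ b v)
      (L≺R : ∀ v i → L v i ≺ R v i)
      (unbounded : ∀ v i → i ≢ a v → i ≢ b v → ∀ w → ¬ (L w i ≺ L v i) × ¬ (R v i ≺ R w i))
      (triangle-free : ∀ {u v w} → Adjacent u v → Adjacent v w → Adjacent u w → ⊥) where

      On : Fin n → Fin d → Set
      On v i = i ≡ a v ⊎ i ≡ b v

      On? : ∀ v i → Dec (On v i)
      On? v i = (i Finₚ.≟ a v) ⊎-dec (i Finₚ.≟ b v)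

      -- The interval of `v` reaches at least as far as that of `w` on both sides, and the latter is
      -- nonempty.
      off-ov : ∀ {v i} → ¬ On v i → ∀ w → Ov v w i
      off-ov {v} {i} off w with h , k ← unbounded v i (off ∘ inj₁) (off ∘ inj₂) w = ≼-≺-trans h (L≺R w i) , ≺-≼-trans (L≺R w i) k

      -- In every other dimension one of the two intervals is unbounded, so only shared dimensions
      -- can keep two boxes apart.
      adj-intro : ∀ {u v} → u ≢ v → (∀ i → On u i → On v i → Ov u v i) → Adjacent u v
      adj-intro {u} {v} u≢v common = u≢v , λ i → go i (On? u i) (On? v i)
        where
        go : ∀ i → Dec (On u i) → Dec (On v i) → Ov u v i
        go i (yes p) (yes q) = common i p q
        go i (no ¬p) _       = off-ov ¬p v
        go i (yes _) (no ¬q) = swap (off-ov ¬q u)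

      inside-on : ∀ {u v i} → Inside u v i → On u i
      inside-on {u} {v} {i} (p , _) with On? u i
      ... | yes on = on
      ... | no off = contradiction p (proj₁ (unbounded u i (off ∘ inj₁) (off ∘ inj₂) v))

      Same : Fin n → Fin n → Set
      Same u v = a u ≡ a v × b u ≡ b v

      Same? : B.Decidable Same
      Same? u v = (a u Finₚ.≟ a v) ×-dec (b u Finₚ.≟ b v)

      same-sym : ∀ {u v} → Same u v → Same v u
      same-sym (p , q) = sym p , sym q

      same-on : ∀ {u v i} → Same u v → On u i → On v i
      same-on (p , q) (inj₁ h) = inj₁ (trans h p)
      same-on (p , q) (inj₂ h) = inj₂ (trans h q)

      -- Since `a v ≤ b v`, these are the least and the greatest element of the set of dimensions,
      -- so the set determines the pair.
      on-same : ∀ {u v} → (∀ i → On u i → On v i) → (∀ i → On v i → On u i) → Same u v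
      on-same {u} {v} u⊆v v⊆u = Finₚ.≤-antisym (least v⊆u) (least u⊆v) , Finₚ.≤-antisym (greatest u⊆v) (greatest v⊆u)
        where
        least : ∀ {x y} → (∀ i → On y i → On x i) → a x Fin.≤ a y
        least {x} {y} y⊆x with y⊆x (a y) (inj₁ refl)
        ... | inj₁ h = Finₚ.≤-reflexive (sym h)
        ... | inj₂ h = Finₚ.≤-trans (a≤b x) (Finₚ.≤-reflexive (sym h))
        greatest : ∀ {x y} → (∀ i → On x i → On y i) → b x Fin.≤ b y
        greatest {x} {y} x⊆y with x⊆y (b x) (inj₂ refl)
        ... | inj₁ h = Finₚ.≤-trans (Finₚ.≤-reflexive h) (a≤b y)
        ... | inj₂ h = Finₚ.≤-reflexive h

      -- Non-crossing edges: corner counting and five colours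

      E : Fin n → Fin n → Set
      E u v = Adjacent u v × Same u v × ¬ Crossing u v

      E? : B.Decidable E
      E? u v = Adjacent? u v ×-dec (Same? u v ×-dec ¬? (Crossing? u v))

      E-sym : B.Symmetric E
      E-sym (adj , same , flat) = Adjacent-sym adj , same-sym same , λ { (i , j , p , q) → flat (j , i , q , p) }

      Corner : Bool → Bool → Fin n → Fin n → Set
      Corner s t u v = E u v × (Slot s u v (a u) × Slot t u v (b u))

      Corner? : ∀ s t u v → Dec (Corner s t u v)
      Corner? s t u v = E? u v ×-dec (Slot? s u v (a u) ×-dec Slot? t u v (b u))

      -- Two boxes containing the same corner of `u` overlap there in both of their dimensions, and
      -- would form a triangle with `u`.
      corner-unique : ∀ s t u v w → Corner s t u v → Corner s t u w → v ≡ w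
      corner-unique s t u v w ((uv , same , _) , pa , pb) ((uw , _) , qa , qb) with v Finₚ.≟ w
      ... | yes v≡w = v≡w
      ... | no v≢w = ⊥-elim (triangle-free uv (adj-intro v≢w common) uw)
        where
        common : ∀ i → On v i → On w i → Ov v w i
        common i onv _ with same-on (same-sym same) onv
        ... | inj₁ refl = slot-ov s pa qa (proj₂ uv i) (proj₂ uw i)
        ... | inj₂ refl = slot-ov t pb qb (proj₂ uv i) (proj₂ uw i)

      corners : Fin n → Fin n → ℕ
      corners u v = (ind (Corner? true true u v) + ind (Corner? true false u v)) +
                    (ind (Corner? false true u v) + ind (Corner? false false u v))

      corners-row : ∀ u → sum (corners u) ≤ 4
      corners-row u = subst (_≤ 4) (sym split)
        (ℕₚ.+-mono-≤ (ℕₚ.+-mono-≤ (one true true) (one true false)) (ℕₚ.+-mono-≤ (one false true) (one false false)))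
        where
        c : Bool → Bool → Fin n → ℕ
        c s t v = ind (Corner? s t u v)
        one : ∀ s t → sum (c s t) ≤ 1
        one s t = sum-ind≤1 (Corner? s t u) (corner-unique s t u)
        split : sum (corners u) ≡ (sum (c true true) + sum (c true false)) + (sum (c false true) + sum (c false false))
        split = trans (∑-distrib-+ (λ v → c true true v + c true false v) (λ v → c false true v + c false false v))
          (cong₂ _+_ (∑-distrib-+ (c true true) (c true false)) (∑-distrib-+ (c false true) (c false false)))

      -- A corner is a choice of one end in each dimension, so on an edge the sum over the four
      -- corners factors.
      corners-product : ∀ {u v} → E u v → corners u v ≡ ends u v (a u) * ends u v (b u)
      corners-product {u} {v} e = trans
        (cong₂ _+_ (cong₂ _+_ (split true true) (split true false)) (cong₂ _+_ (split false true) (split false false)))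
        (expand (x true) (x false) (y true) (y false))
        where
        x y : Bool → ℕ
        x s = ind (Slot? s u v (a u))
        y t = ind (Slot? t u v (b u))
        split : ∀ s t → ind (Corner? s t u v) ≡ x s * y t
        split s t = trans (ind-× (E? u v) (Slot? s u v (a u) ×-dec Slot? t u v (b u)))
          (trans (cong₂ _*_ (ind-yes (E? u v) e) (ind-× (Slot? s u v (a u)) (Slot? t u v (b u)))) (ℕₚ.*-identityˡ _))
        expand : ∀ p q r s → (p * r + p * s) + (q * r + q * s) ≡ (p + q) * (r + s)
        expand = solve-∀

      corners-edge : ∀ u v → E u v → 2 ≤ corners u v + corners v u
      corners-edge u v e@(_ , same@(au≡av , bu≡bv) , flat) =
        subst (2 ≤_) (sym (cong₂ _+_ (corners-product e) vu))
          (2≤products (ends u v (a u)) (ends u v (b u)) (ends v u (a u)) (ends v u (b u)) (2≤ends u v (a u)) (2≤ends u v (b u))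
            (λ { (p , q) → flat (b u , a u , ends≡0⇒Inside v u (b u) q , ends≡0⇒Inside u v (a u) p) })
            (λ { (p , q) → flat (a u , b u , ends≡0⇒Inside v u (a u) p , ends≡0⇒Inside u v (b u) q) }))
        where
        vu : corners v u ≡ ends v u (a u) * ends v u (b u)
        vu = trans (corners-product (E-sym e)) (cong₂ _*_ (cong (ends v u) (sym au≡av)) (cong (ends v u) (sym bu≡bv)))

      flat-5-colouring : ∃ λ (c : Fin n → Fin 5) → ∀ u v → E u v → c u ≢ c v
      flat-5-colouring = weighted-degeneracy-colouring n E? E-sym (λ e → proj₁ (proj₁ e) refl) corners corners-row corners-edge

      -- Thin vertices

      Thin : Fin n → Fin d → Set
      Thin u i = ∃ λ v → Adjacent u v × Same u v × Inside u v i

      Thin? : ∀ u i → Dec (Thin u i)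
      Thin? u i = Finₚ.any? λ v → Adjacent? u v ×-dec (Same? u v ×-dec Inside? u v i)

      -- The neighbour `v` that witnesses thinness contains `u` in dimension `i`, hence overlaps `w`
      -- there. It shares no other dimension with `w`, so `u`, `v`, `w` would be a triangle.
      thin-isolated : ∀ {u w i} → Thin u i → Adjacent u w → ¬ Same u w → (∀ j → On u j → On w j → j ≡ i) → ⊥
      thin-isolated {u} {w} {i} (v , uv , same , inside) uw differ common =
        triangle-free (Adjacent-sym uv) uw (adj-intro (λ { refl → differ same }) ov)
        where
        ov : ∀ j → On v j → On w j → Ov v w j
        ov j onv onw with common j (same-on (same-sym same) onv) onw
        ... | refl = ov-inside inside (proj₂ uw i)

      -- A witness `w` for `v` would also overlap `u`: in dimension `i` because `w` contains `v`, in
      -- dimension `j` because `u` contains `v`. So at a crossing, thinness in `i` tells the two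
      -- vertices apart.
      crossed-not-thin : ∀ {u v i j} → Adjacent u v → Same u v → Inside u v i → Inside v u j → ¬ Thin v i
      crossed-not-thin {u} {v} {i} {j} uv same ins-i ins-j (w , vw , same′ , ins) =
        triangle-free uv vw (adj-intro u≢w ov)
        where
        u≢w : u ≢ w
        u≢w refl = Inside-asym ins-i ins
        ov : ∀ k → On u k → On w k → Ov u w k
        -- `i` and `j` are distinct since the inclusions are opposite, hence they are all the
        -- dimensions of `u`.
        ov k onu _ with two-elements (inside-on ins-i) (same-on (same-sym same) (inside-on ins-j)) (λ { refl → Inside-asym ins-i ins-j }) onu
        ... | inj₁ refl = swap (ov-inside ins (proj₂ (Adjacent-sym uv) k))
        ... | inj₂ refl = ov-inside ins-j (proj₂ vw k)

      disjoint-adj : ∀ {u v} → (∀ i → On u i → ¬ On v i) → Adjacent u v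
      disjoint-adj disj = adj-intro (λ { refl → disj _ (inj₁ refl) (inj₁ refl) }) (λ i p q → contradiction q (disj i p))

      -- These are the edges that the 5-colouring may leave monochromatic; pairing `q` with it
      -- colours `H` properly.
      Separates : {K : Set} → (Fin n → Set) → (Fin n → K) → Set
      Separates H q = ∀ u v → H u → H v → Adjacent u v → ¬ E u v → q u ≢ q v

      crossing : ∀ {u v} → Adjacent u v → Same u v → ¬ E u v → Crossing u v
      crossing {u} {v} uv same ¬e = decidable-stable (Crossing? u v) λ flat → ¬e (uv , same , flat)

      -- A star of dimension pairs: two separating colours

      module Star {H : Fin n → Set} (H? : U.Decidable H) (e : Fin d) (on-e : ∀ {v} → H v → On v e) where

        -- If both dimensions equal `e` the result is `e`, so boxes with the single dimension `e`
        -- form a class of their own.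
        pick : Fin d → Fin d → Fin d
        pick x y with x Finₚ.≟ e
        ... | yes _ = y
        ... | no _  = x

        other : Fin n → Fin d
        other v = pick (a v) (b v)

        on-other : ∀ v → On v (other v)
        on-other v with a v Finₚ.≟ e
        ... | yes _ = inj₂ refl
        ... | no _  = inj₁ refl

        on-cases : ∀ {v i} → On v e → On v i → i ≡ e ⊎ i ≡ other v
        on-cases {v} on-e on-i with a v Finₚ.≟ e
        on-cases on-e        (inj₁ refl) | yes av≡e = inj₁ av≡e
        on-cases on-e        (inj₂ refl) | yes av≡e = inj₂ refl
        on-cases (inj₁ refl) on-i        | no av≢e = contradiction refl av≢e
        on-cases (inj₂ refl) (inj₁ refl) | no av≢e = inj₂ refl
        on-cases (inj₂ refl) (inj₂ refl) | no av≢e = inj₁ refl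

        other-⊆ : ∀ {u v} → H u → H v → other u ≡ other v → ∀ i → On u i → On v i
        other-⊆ {u} {v} hu hv eq i on with on-cases (on-e hu) on
        ... | inj₁ refl = on-e hv
        ... | inj₂ refl = subst (On v) (sym eq) (on-other v)

        other-same : ∀ {u v} → H u → H v → other u ≡ other v → Same u v
        other-same hu hv eq = on-same (other-⊆ hu hv eq) (other-⊆ hv hu (sym eq))

        common : ∀ {u v} → H u → H v → other u ≢ other v → ∀ i → On u i → On v i → i ≡ e
        common hu hv differ i onu onv with on-cases (on-e hu) onu | on-cases (on-e hv) onv
        ... | inj₁ i≡e | _        = i≡e
        ... | inj₂ _   | inj₁ i≡e = i≡e
        ... | inj₂ p   | inj₂ q   = contradiction (trans (sym p) q) differ

        _~_ : Fin n → Fin n → Set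
        u ~ v = H u × H v × Ov u v e

        _≼_ : Fin n → Fin n → Set
        u ≼ v = ¬ (L v e ≺ L u e)

        ≼-total : B.Total _≼_
        ≼-total u v with L v e ≺? L u e
        ... | no h  = inj₁ h
        ... | yes h = inj₂ (≺-asym h)

        -- The vertices are ordered by left ends in direction `e`: intervals that meet `v` and start
        -- no later than `v` all contain the left end of `v`. Vertices of different classes share
        -- only `e`, so three overlapping ones of distinct classes would be a triangle.
        two-colours : ∃ λ (p : Fin n → Bool) → ∀ u v → u ~ v → (other u ≡ other v → p u ≡ p v) × (other u ≢ other v → p u ≢ p v)
        two-colours = chordal-2-colouring n Finₚ._≟_ other {_~_} {_≼_}
          (λ u v → H? u ×-dec (H? v ×-dec ((L u e ≺? R v e) ×-dec (L v e ≺? R u e))))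
          (λ { (hu , hv , ov) → hv , hu , swap ov })
          ≼-total
          (λ p q h → q (≺-≼-trans h p))
          (λ { (hu , _ , ov) (hu′ , _ , ov′) p q → hu , hu′ , ≼-≺-trans p (proj₂ ov′) , ≼-≺-trans q (proj₂ ov) })
          (λ { (hu , hv , uv) (_ , hw , vw) (_ , _ , uw) u≢v v≢w u≢w →
             triangle-free (near hu hv u≢v uv) (near hv hw v≢w vw) (near hu hw u≢w uw) })
          where
          near : ∀ {u v} → H u → H v → other u ≢ other v → Ov u v e → Adjacent u v
          near hu hv differ ov = adj-intro (λ { refl → differ refl })
            λ i onu onv → subst (Ov _ _) (sym (common hu hv differ i onu onv)) ov

        colour : Fin n → Bool
        colour v = does (Thin? v e) xor proj₁ two-colours v

        separates : Separates H colour
        separates u v hu hv uv ¬e with proj₂ two-colours u v (hu , hv , proj₂ uv e) | Same? u v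
        -- Different classes share only `e`, so neither vertex is thin in `e` and the 2-colouring
        -- decides.
        ... | eq , ne | no differ
          rewrite dec-false (Thin? u e) (λ thin → thin-isolated thin uv differ (common hu hv (differ ∘ other-same hu hv)))
                | dec-false (Thin? v e) (λ thin → thin-isolated thin (Adjacent-sym uv) (differ ∘ same-sym)
                    (common hv hu (differ ∘ other-same hu hv ∘ sym)))
          = ne (differ ∘ other-same hu hv)
        -- Within a class the 2-colouring agrees on both ends. One of the two crossing dimensions is
        -- `e`, and exactly the vertex strictly inside the other there is thin in `e`.
        ... | eq , ne | yes same@(au≡av , bu≡bv) with i , j , ins-i , ins-j ← crossing uv same ¬e
          with two-elements (inside-on ins-i) (same-on (same-sym same) (inside-on ins-j)) (λ { refl → Inside-asym ins-i ins-j }) (on-e hu)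
        ...   | inj₁ refl
          rewrite dec-true (Thin? u e) (v , uv , same , ins-i)
                | dec-false (Thin? v e) (crossed-not-thin uv same ins-i ins-j)
          = not-¬ (sym (eq (cong₂ pick au≡av bu≡bv))) ∘ sym
        ...   | inj₂ refl
          rewrite dec-true (Thin? v e) (u , Adjacent-sym uv , same-sym same , ins-j)
                | dec-false (Thin? u e) (crossed-not-thin (Adjacent-sym uv) (same-sym same) ins-j ins-i)
          = not-¬ (eq (cong₂ pick au≡av bu≡bv))

      -- κ v is the corner of the triangle opposite to the edge formed by the dimensions of v.
      record Triangle (H : Fin n → Set) : Set where
        field
          t       : Fin 3 → Fin d
          t-inj   : ∀ {k l} → t k ≡ t l → k ≡ l
          κ       : Fin n → Fin 3
          onto    : ∀ {v} → H v → On v (t (nxt (κ v))) × On v (t (nxt (nxt (κ v))))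
          witness : ∀ k → ∃ λ v → H v × On v (t (nxt k)) × On v (t (nxt (nxt k)))

        on-cases : ∀ {v k i} → On v (t (nxt k)) × On v (t (nxt (nxt k))) → On v i → i ≡ t (nxt k) ⊎ i ≡ t (nxt (nxt k))
        on-cases {k = k} (p , q) = two-elements p q (λ eq → nxt-≢ (nxt k) (sym (t-inj eq)))

        -- The tested dimension is the one shared with the class `nxt (κ v)`. A vertex thin in it
        -- has no neighbour in that class and may therefore take its colour.
        colour : Fin n → Fin 3
        colour v with Thin? v (t (nxt (nxt (κ v))))
        ... | yes _ = nxt (κ v)
        ... | no _  = κ v

        neighbour-classes : ∀ {u v} → H u → H v → Adjacent u v → κ v ≡ nxt (κ u) → colour u ≢ colour v
        neighbour-classes {u} {v} hu hv uv κv eq with Thin? u (t (nxt (nxt (κ u)))) | Thin? v (t (nxt (nxt (κ v))))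
        ... | no _     | no _  = nxt-≢ (κ u) (trans (sym κv) (sym eq))
        ... | no _     | yes _ = nxt²-≢ (κ u) (trans (cong nxt (sym κv)) (sym eq))
        ... | yes _    | yes _ = nxt-≢ (nxt (κ u)) (trans (cong nxt (sym κv)) (sym eq))
        -- The only combination of cases in which the two colours coincide; thinness of `u` excludes
        -- the edge.
        ... | yes thin | no _  = thin-isolated thin uv differ common
          where
          onv : On v (t (nxt (nxt (κ u)))) × On v (t (nxt (nxt (nxt (κ u)))))
          onv = subst (λ k → On v (t (nxt k)) × On v (t (nxt (nxt k)))) κv (onto hv)
          off-v : ¬ On v (t (nxt (κ u)))
          off-v on with on-cases onv on
          ... | inj₁ h = nxt-≢ (nxt (κ u)) (sym (t-inj h))
          ... | inj₂ h = nxt²-≢ (nxt (κ u)) (sym (t-inj h))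
          differ : ¬ Same u v
          differ same = off-v (same-on same (proj₁ (onto hu)))
          common : ∀ i → On u i → On v i → i ≡ t (nxt (nxt (κ u)))
          common i on-u on-v with on-cases (onto hu) on-u
          ... | inj₁ refl = contradiction on-v off-v
          ... | inj₂ h    = h

        ⊆-class : ∀ {u v} → H u → H v → κ u ≡ κ v → ∀ i → On u i → On v i
        ⊆-class {v = v} hu hv eq i on with on-cases (onto hu) on
        ... | inj₁ refl = subst (λ k → On v (t (nxt k))) (sym eq) (proj₁ (onto hv))
        ... | inj₂ refl = subst (λ k → On v (t (nxt (nxt k)))) (sym eq) (proj₂ (onto hv))

        crossed : ∀ {u v i j} → κ u ≡ κ v → Adjacent u v → Same u v → Inside u v i → Inside v u j →
          i ≡ t (nxt (nxt (κ u))) → colour u ≢ colour v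
        crossed {u} {v} κ≡ uv same ins-i ins-j refl eq with Thin? u (t (nxt (nxt (κ u)))) | Thin? v (t (nxt (nxt (κ v))))
        ... | no ¬thin | _        = ¬thin (v , uv , same , ins-i)
        ... | yes _    | yes thin = crossed-not-thin uv same ins-i ins-j (subst (λ k → Thin v (t (nxt (nxt k)))) (sym κ≡) thin)
        ... | yes _    | no _     = nxt-≢ (κ u) (trans eq (sym κ≡))

        separates : Separates H colour
        separates u v hu hv uv ¬e with nxt-cases (κ u) (κ v)
        ... | inj₂ (inj₁ κv) = neighbour-classes hu hv uv κv
        ... | inj₂ (inj₂ κu) = neighbour-classes hv hu (Adjacent-sym uv) κu ∘ sym
        ... | inj₁ κv with same ← on-same (⊆-class hu hv (sym κv)) (⊆-class hv hu κv)
          with i , j , ins-i , ins-j ← crossing uv same ¬e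
          with on-j ← same-on (same-sym same) (inside-on ins-j)
          -- The crossing dimensions `i` and `j` are both dimensions of the class, so one of them is
          -- the tested dimension.
          with two-elements (inside-on ins-i) on-j (λ { refl → Inside-asym ins-i ins-j }) (proj₂ (onto hu))
        ...   | inj₁ h = crossed (sym κv) uv same ins-i ins-j (sym h)
        ...   | inj₂ h = crossed κv (Adjacent-sym uv) (same-sym same) ins-j ins-i
                           (trans (sym h) (cong (t ∘ nxt ∘ nxt) (sym κv))) ∘ sym

      -- Pairwise intersecting dimension pairs

      Meet : Fin n → Fin n → Set
      Meet u v = ∃ λ i → On u i × On v i

      Meet? : B.Decidable Meet
      Meet? u v = Finₚ.any? λ i → On? u i ×-dec On? v i

      -- If neither dimension of `u` is common to all of `H`, some `v` misses `a u` and some `w`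
      -- misses `b u`. With `z` common to `v` and `w`, the three pairs are the edges of a triangle,
      -- and any pair meeting all of them is again one of its edges.
      star-or-triangle : {H : Fin n → Set} → U.Decidable H → (∀ {u v} → H u → H v → Meet u v) →
        (∀ v → ¬ H v) ⊎ (∃ λ e → ∀ {v} → H v → On v e) ⊎ Triangle H
      star-or-triangle {H} H? meet with Finₚ.any? H?
      ... | no none = inj₁ λ v h → none (v , h)
      ... | yes (u , hu) with Finₚ.any? (λ v → H? v ×-dec ¬? (On? v (a u)))
      ...   | no all-a = inj₂ (inj₁ (a u , λ {v} h → decidable-stable (On? v (a u)) λ off → all-a (v , h , off)))
      ...   | yes (v , hv , v∌a) with Finₚ.any? (λ v → H? v ×-dec ¬? (On? v (b u)))
      ...     | no all-b = inj₂ (inj₁ (b u , λ {v} h → decidable-stable (On? v (b u)) λ off → all-b (v , h , off)))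
      ...     | yes (w , hw , w∌b) with z , v∋z , w∋z ← meet hv hw = inj₂ (inj₂ record
                 { t = t ; t-inj = t-inj _ _ ; κ = λ s → κ-of (On? s x) (On? s y)
                 ; onto = λ {s} hs → onto hs (On? s x) (On? s y) ; witness = witness })
        where
        x y : Fin d
        x = a u
        y = b u
        meets-b : ∀ {s} → H s → ¬ On s x → On s y
        meets-b hs s∌x with meet hs hu
        ... | _ , on , inj₁ refl = contradiction on s∌x
        ... | _ , on , inj₂ refl = on
        meets-a : ∀ {s} → H s → ¬ On s y → On s x
        meets-a hs s∌y with meet hs hu
        ... | _ , on , inj₁ refl = on
        ... | _ , on , inj₂ refl = contradiction on s∌y
        v∋y : On v y
        v∋y = meets-b hv v∌a
        w∋x : On w x
        w∋x = meets-a hw w∌b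
        x≢y : x ≢ y
        x≢y eq = v∌a (subst (On v) (sym eq) v∋y)
        x≢z : x ≢ z
        x≢z refl = v∌a v∋z
        y≢z : y ≢ z
        y≢z refl = w∌b w∋z
        t : Fin 3 → Fin d
        t zero             = x
        t (suc zero)       = y
        t (suc (suc zero)) = z
        t-inj : ∀ k l → t k ≡ t l → k ≡ l
        t-inj zero zero _                         = refl
        t-inj zero (suc zero) eq                  = contradiction eq x≢y
        t-inj zero (suc (suc zero)) eq            = contradiction eq x≢z
        t-inj (suc zero) zero eq                  = contradiction (sym eq) x≢y
        t-inj (suc zero) (suc zero) _             = refl
        t-inj (suc zero) (suc (suc zero)) eq      = contradiction eq y≢z
        t-inj (suc (suc zero)) zero eq            = contradiction (sym eq) x≢z
        t-inj (suc (suc zero)) (suc zero) eq      = contradiction (sym eq) y≢z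
        t-inj (suc (suc zero)) (suc (suc zero)) _ = refl
        -- The corner missing from the pair: `x` or `y` if absent, otherwise `z`.
        κ-of : {P Q : Set} → Dec P → Dec Q → Fin 3
        κ-of (no _)  _       = zero
        κ-of (yes _) (no _)  = suc zero
        κ-of (yes _) (yes _) = suc (suc zero)
        onto : ∀ {s} → H s → (x? : Dec (On s x)) (y? : Dec (On s y)) →
          On s (t (nxt (κ-of x? y?))) × On s (t (nxt (nxt (κ-of x? y?))))
        onto hs (yes s∋x) (yes s∋y) = s∋x , s∋y
        onto hs (no s∌x) _ with meet hs hw
        ... | i , s∋i , w∋i with two-elements w∋x w∋z x≢z w∋i
        ...   | inj₁ refl = contradiction s∋i s∌x
        ...   | inj₂ refl = meets-b hs s∌x , s∋i
        onto hs (yes s∋x) (no s∌y) with meet hs hv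
        ... | i , s∋i , v∋i with two-elements v∋y v∋z y≢z v∋i
        ...   | inj₁ refl = contradiction s∋i s∌y
        ...   | inj₂ refl = s∋i , s∋x
        witness : ∀ k → ∃ λ s → H s × On s (t (nxt k)) × On s (t (nxt (nxt k)))
        witness zero             = v , hv , v∋y , v∋z
        witness (suc zero)       = w , hw , w∋z , w∋x
        witness (suc (suc zero)) = u , hu , inj₁ refl , inj₂ refl

      -- Combining colourings

      ProperOn : ∀ {k} → (Fin n → Set) → (Fin n → Fin k) → Set
      ProperOn H c = ∀ u v → H u → H v → Adjacent u v → c u ≢ c v

      merge : ∀ {k l} {H P : Fin n → Set} (P? : U.Decidable P) →
        (∃ λ (c : Fin n → Fin k) → ProperOn (λ v → H v × P v) c) →
        (∃ λ (c : Fin n → Fin l) → ProperOn (λ v → H v × ¬ P v) c) →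
        ∃ λ (c : Fin n → Fin (k + l)) → ProperOn H c
      merge {k} {l} {H} P? (c , c-ok) (c′ , c′-ok) = colour , proper
        where
        colour : Fin n → Fin (k + l)
        colour v with P? v
        ... | yes _ = c v Fin.↑ˡ l
        ... | no _  = k Fin.↑ʳ c′ v
        apart : ∀ i j → i Fin.↑ˡ l ≢ k Fin.↑ʳ j
        apart i j eq with () ← trans (sym (Finₚ.splitAt-↑ˡ k i l)) (trans (cong (Fin.splitAt k) eq) (Finₚ.splitAt-↑ʳ k l j))
        proper : ProperOn H colour
        proper u v hu hv uv eq with P? u | P? v
        ... | yes pu | yes pv = c-ok u v (hu , pu) (hv , pv) uv (Finₚ.↑ˡ-injective l _ _ eq)
        ... | yes _  | no _   = apart _ _ eq
        ... | no _   | yes _  = apart _ _ (sym eq)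
        ... | no ¬pu | no ¬pv = c′-ok u v (hu , ¬pu) (hv , ¬pv) uv (Finₚ.↑ʳ-injective k _ _ eq)

      neighbours-independent : {H : Fin n → Set} → ∀ v → ∃ λ (c : Fin n → Fin 1) → ProperOn (λ u → H u × Adjacent v u) c
      neighbours-independent v = (λ _ → zero) , λ u w (_ , vu) (_ , vw) uw _ → triangle-free vu uw vw

      separated-colouring : ∀ {k} {H : Fin n → Set} {q : Fin n → Fin k} → Separates H q →
        ∃ λ (c : Fin n → Fin (k * 5)) → ProperOn H c
      separated-colouring {k} {H} {q} sep with c , proper ← flat-5-colouring = (λ v → Fin.combine (q v) (c v)) , separate
        where
        separate : ProperOn H (λ v → Fin.combine (q v) (c v))
        separate u v hu hv uv eq with Finₚ.combine-injective (q u) (c u) (q v) (c v) eq | E? u v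
        ... | _ , c≡ | yes e = proper u v e c≡
        ... | q≡ , _ | no ¬e = sep u v hu hv uv ¬e q≡

      bit : Bool → Fin 2
      bit false = zero
      bit true  = suc zero

      bit-injective : ∀ {x y} → bit x ≡ bit y → x ≡ y
      bit-injective {false} {false} _ = refl
      bit-injective {true}  {true}  _ = refl

      star-colouring : {H : Fin n → Set} → U.Decidable H → (∃ λ e → ∀ {v} → H v → On v e) →
        ∃ λ (c : Fin n → Fin 10) → ProperOn H c
      star-colouring H? (e , on-e) = separated-colouring {q = bit ∘ colour}
        λ u v hu hv uv ¬e → separates u v hu hv uv ¬e ∘ bit-injective
        where open Star H? e on-e

      -- Vertices with a disjoint partner

      Light : Fin n → Set
      Light v = ∃ λ w → ¬ Meet v w

      Light? : U.Decidable Light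
      Light? v = Finₚ.any? λ w → ¬? (Meet? v w)

      heavy-meet : ∀ {v} → ¬ Light v → ∀ w → Meet v w
      heavy-meet {v} heavy w = decidable-stable (Meet? v w) λ h → heavy (w , h)

      apart-adj : ∀ {u v} → ¬ Meet u v → Adjacent u v
      apart-adj apart = disjoint-adj λ i p q → apart (i , p , q)

      inject-colouring : ∀ {k} {H : Fin n → Set} → k ≤ 18 → (∃ λ (c : Fin n → Fin k) → ProperOn H c) →
        ∃ λ (c : Fin n → Fin 18) → ProperOn H c
      inject-colouring k≤18 (c , proper) = (λ v → Fin.inject≤ (c v) k≤18) ,
        λ u v hu hv uv eq → proper u v hu hv uv (Finₚ.inject≤-injective k≤18 k≤18 _ _ eq)

      module _ (A B : Fin n) (A∩B≡∅ : ¬ Meet A B) where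

        -- For `v` meeting both `A` and `B`, each bit selects a dimension shared with that vertex:
        -- its `a` if possible, otherwise its `b`.
        key : Fin n → Fin 4
        key v = Fin.combine (bit (does (On? v (a A)))) (bit (does (On? v (a B))))

        common-point : ∀ {u v} C → Meet u C → Meet v C → does (On? u (a C)) ≡ does (On? v (a C)) →
          ∃ λ i → On C i × On u i × On v i
        common-point {u} {v} C u∩C v∩C eq with agreement (On? u (a C)) (On? v (a C)) eq
        ... | inj₁ (p , q) = a C , inj₁ refl , p , q
        ... | inj₂ (p , q) = b C , inj₂ refl , last u∩C p , last v∩C q
          where
          last : ∀ {w} → Meet w C → ¬ On w (a C) → On w (b C)
          last (_ , on , inj₁ refl) off = contradiction on off
          last (_ , on , inj₂ refl) off = on

        -- Equal keys give a common dimension `α` from `A` and `β` from `B`. These differ because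
        -- `A` and `B` are disjoint, so they exhaust both pairs.
        key-same : ∀ {u v} → ¬ Adjacent A u → ¬ Adjacent A v → ¬ Adjacent B u → ¬ Adjacent B v → key u ≡ key v → Same u v
        key-same {u} {v} Au Av Bu Bv eq = on-same (within u∋α u∋β v∋α v∋β) (within v∋α v∋β u∋α u∋β)
          where
          meets : ∀ {C w} → ¬ Adjacent C w → Meet w C
          meets {C} {w} h = decidable-stable (Meet? w C) λ apart → h (Adjacent-sym (apart-adj apart))
          keys = Finₚ.combine-injective (bit (does (On? u (a A)))) (bit (does (On? u (a B))))
                                          (bit (does (On? v (a A)))) (bit (does (On? v (a B)))) eq
          α-point = common-point A (meets Au) (meets Av) (bit-injective (proj₁ keys))
          β-point = common-point B (meets Bu) (meets Bv) (bit-injective (proj₂ keys))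
          α β : Fin d
          α = proj₁ α-point
          β = proj₁ β-point
          u∋α : On u α
          u∋α = proj₁ (proj₂ (proj₂ α-point))
          v∋α : On v α
          v∋α = proj₂ (proj₂ (proj₂ α-point))
          u∋β : On u β
          u∋β = proj₁ (proj₂ (proj₂ β-point))
          v∋β : On v β
          v∋β = proj₂ (proj₂ (proj₂ β-point))
          α≢β : α ≢ β
          α≢β α≡β = A∩B≡∅ (α , proj₁ (proj₂ α-point) , subst (On B) (sym α≡β) (proj₁ (proj₂ β-point)))
          within : ∀ {x y} → On x α → On x β → On y α → On y β → ∀ i → On x i → On y i
          within xα xβ yα yβ i xi with two-elements xα xβ α≢β xi
          ... | inj₁ refl = yα
          ... | inj₂ refl = yβ

        -- Vertices with equal keys have the same dimensions, so a partner disjoint from one is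
        -- adjacent to both.
        light-colouring : {H : Fin n → Set} → (∀ {v} → H v → Light v × ¬ Adjacent A v × ¬ Adjacent B v) →
          ∃ λ (c : Fin n → Fin 4) → ProperOn H c
        light-colouring spec = key , proper
          where
          proper : ProperOn _ key
          proper u v hu hv uv eq with spec hu | spec hv
          ... | (w , u∩w) , Au , Bu | _ , Av , Bv =
            triangle-free uv (apart-adj λ { (i , vi , wi) → u∩w (i , same-on (same-sym same) vi , wi) }) (apart-adj u∩w)
            where
            same : Same u v
            same = key-same Au Av Bu Bv eq

        -- `A` and `B` each meet all three edges of the triangle, hence each contains two of its
        -- three corners, which is impossible for disjoint sets.
        no-triangle : {H : Fin n → Set} → (∀ {v} → H v → ¬ Light v) → ¬ Triangle H
        no-triangle heavy T = go (On? A (t zero))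
          where
          open Triangle T
          edge : ∀ C k → On C (t (nxt k)) ⊎ On C (t (nxt (nxt k)))
          edge C k with v , hv , on ← witness k with i , vi , Ci ← heavy-meet (heavy hv) C with on-cases on vi
          ... | inj₁ refl = inj₁ Ci
          ... | inj₂ refl = inj₂ Ci
          resolve : ∀ {P Q : Set} → ¬ P → P ⊎ Q → Q
          resolve ¬p = Sum.fromInj₂ (⊥-elim ∘ ¬p)
          A⇒∌B : ∀ {i} → On A i → ¬ On B i
          A⇒∌B Ai Bi = A∩B≡∅ (_ , Ai , Bi)
          go : Dec (On A (t zero)) → ⊥
          go (yes A0) = [ (λ A1 → A⇒∌B A1 B1) , (λ A2 → A⇒∌B A2 B2) ]′ (edge A zero)
            where
            B1 = resolve (A⇒∌B A0) (edge B (suc (suc zero)))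
            B2 = resolve (A⇒∌B A0) (Sum.swap (edge B (suc zero)))
          go (no A∌0) = [ A⇒∌B A1 , A⇒∌B A2 ]′ (edge B zero)
            where
            A1 = resolve A∌0 (edge A (suc (suc zero)))
            A2 = resolve A∌0 (Sum.swap (edge A (suc zero)))

        -- The palette is 1 + 1 + 4 + 10: neighbours of `A`, neighbours of `B`, remaining light
        -- vertices by key, and the heavy star.
        light-heavy-colouring : ∃ λ (c : Fin n → Fin 16) → ProperOn (λ _ → ⊤) c
        light-heavy-colouring = merge (Adjacent? A) (neighbours-independent A) (merge (Adjacent? B) (neighbours-independent B)
            (merge Light? (light-colouring (λ { (((_ , Av) , Bv) , light) → light , Av , Bv })) heavy))
          where
          H : Fin n → Set
          H v = ((⊤ × ¬ Adjacent A v) × ¬ Adjacent B v) × ¬ Light v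
          H? : U.Decidable H
          H? v = ((yes tt ×-dec ¬? (Adjacent? A v)) ×-dec ¬? (Adjacent? B v)) ×-dec ¬? (Light? v)
          heavy : ∃ λ (c : Fin n → Fin 10) → ProperOn H c
          heavy with star-or-triangle H? (λ {u} {v} hu _ → heavy-meet (proj₂ hu) v)
          ... | inj₁ none       = (λ _ → zero) , λ u _ hu → ⊥-elim (none u hu)
          ... | inj₂ (inj₁ star) = star-colouring H? star
          ... | inj₂ (inj₂ T)    = ⊥-elim (no-triangle proj₂ T)

      everywhere : ∀ {k} → (∃ λ (c : Fin n → Fin k) → ProperOn (λ _ → ⊤) c) →
        ∃ λ (c : Fin n → Fin k) → ∀ u v → Adjacent u v → c u ≢ c v
      everywhere (c , proper) = c , λ u v → proper u v tt tt

      18-colouring : ∃ λ (c : Fin n → Fin 18) → ∀ u v → Adjacent u v → c u ≢ c v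
      18-colouring with Finₚ.any? Light?
      ... | yes (A , B , A∩B) = everywhere (inject-colouring (ℕₚ.m≤m+n 16 2) (light-heavy-colouring A B A∩B))
      ... | no heavy with star-or-triangle {λ _ → ⊤} (λ _ → yes tt) (λ {u} {v} _ _ → heavy-meet (λ l → heavy (u , l)) v)
      ...   | inj₁ none        = (λ _ → zero) , λ u → ⊥-elim (none u tt)
      ...   | inj₂ (inj₁ star) = everywhere (inject-colouring (ℕₚ.m≤m+n 10 8) (star-colouring (λ _ → yes tt) star))
      ...   | inj₂ (inj₂ T)    = everywhere (inject-colouring (ℕₚ.m≤m+n 15 3) (separated-colouring (Triangle.separates T)))

-- From boxes in ℝ to cuts

-- The auxiliary function in the definition of localCount has no name outside it; unification recovers
-- it once with-abstraction has made its arguments independent variables.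
mutual
  count : (R : RealLine) (d : ℕ) (B : Box R d) (m : ℕ) → (Fin m → Bool) → ℕ
  count = _

  localCount-suc : ∀ R m (B : Box R (suc m)) → localCount R B ≡
    (if isLocal R (B zero) then suc (count R (suc m) B m (λ i → isLocal R (B (suc i))))
                           else count R (suc m) B m (λ i → isLocal R (B (suc i))))
  localCount-suc R m B with isLocal R (B zero)
  localCount-suc R m B | true with (λ i → isLocal R (B (suc i)))
  ... | f with suc m | B
  ...   | d | B′ = refl
  localCount-suc R m B | false with (λ i → isLocal R (B (suc i)))
  ... | f with suc m | B
  ...   | d | B′ = refl

-- Two dimensions covering the bounded intervals of a box

module Supports (R : RealLine) {d : ℕ} (B : Box R d) where

  count≤0 : ∀ {m} (f : Fin m → Bool) → count R d B m f ≤ 0 → ∀ i → f i ≢ true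
  count≤0 {suc m} f few i with f zero in eq
  count≤0 {suc m} f few zero    | false = λ f0 → contradiction (trans (sym eq) f0) λ ()
  count≤0 {suc m} f few (suc i) | false = count≤0 (f ∘ suc) few i

  count≤1 : ∀ {m} (f : Fin (suc m) → Bool) → count R d B (suc m) f ≤ 1 → ∃ λ a → ∀ i → f i ≡ true → i ≡ a
  count≤1 {m} f few with f zero in eq
  count≤1 {m} f (s≤s few) | true = zero , λ { zero _ → refl ; (suc i) fi → contradiction fi (count≤0 (f ∘ suc) few i) }
  count≤1 {zero} f few | false = zero , λ { zero _ → refl }
  count≤1 {suc m} f few | false with a , only ← count≤1 (f ∘ suc) few =
    suc a , λ { zero f0 → contradiction (trans (sym eq) f0) λ () ; (suc i) fi → cong suc (only i fi) }

  -- The indices `a` and `b` only have to cover the true entries; a nonempty index set supplies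
  -- defaults when there are fewer than two.
  count≤2 : ∀ {m} (f : Fin (suc m) → Bool) → count R d B (suc m) f ≤ 2 → ∃₂ λ a b → ∀ i → f i ≡ true → i ≡ a ⊎ i ≡ b
  count≤2 {m} f few with f zero in eq
  count≤2 {zero} f few | _ = zero , zero , λ { zero _ → inj₁ refl }
  count≤2 {suc m} f (s≤s few) | true with a , only ← count≤1 (f ∘ suc) few =
    zero , suc a , λ { zero _ → inj₁ refl ; (suc i) fi → inj₂ (cong suc (only i fi)) }
  count≤2 {suc m} f few | false with a , b , only ← count≤2 (f ∘ suc) few =
    suc a , suc b , λ { zero f0 → contradiction (trans (sym eq) f0) λ ()
                      ; (suc i) fi → Sum.map (cong suc) (cong suc) (only i fi) }

local-axes : ∀ R {d} (B : Box R (suc d)) → localCount R B ≤ 2 →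
  ∃₂ λ a b → a Fin.≤ b × (∀ i → isLocal R (B i) ≡ true → i ≡ a ⊎ i ≡ b)
local-axes R B few with a , b , only ← Supports.count≤2 R B (λ i → isLocal R (B i)) few with Finₚ.≤-total a b
... | inj₁ a≤b = a , b , a≤b , only
... | inj₂ b≤a = b , a , b≤a , λ i h → Sum.swap (only i h)

-- The real line and its cuts

module Line (R : RealLine) where
  open RealLine R renaming (_<_ to _<ᵣ_; _+_ to _+ᵣ_; _*_ to _*ᵣ_)

  ring : CommutativeRing 0ℓ 0ℓ
  ring = record { isCommutativeRing = isCommutativeRing }

  open CommutativeRing ring using (+-assoc; +-identityˡ; +-identityʳ; -‿inverseˡ; -‿inverseʳ;
    *-identityˡ; *-identityʳ; distribʳ; distribˡ; _-_)
  open Algebra.Properties.Ring (CommutativeRing.ring ring) using (-‿distribˡ-*; -‿involutive)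

  ℝ-strictTotalOrder : StrictTotalOrder 0ℓ 0ℓ 0ℓ
  ℝ-strictTotalOrder = record { isStrictTotalOrder = isStrictTotalOrder }

  open StrictTotalOrder ℝ-strictTotalOrder using () renaming (compare to <-cmp; trans to <-trans; irrefl to <-irrefl; asym to <-asym)

  x<0⇒0<-x : ∀ {x} → x <ᵣ 0# → 0# <ᵣ - x
  x<0⇒0<-x {x} x<0 = subst₂ _<ᵣ_ (-‿inverseʳ x) (+-identityˡ (- x)) (+-mono-< x 0# (- x) x<0)

  0<1 : 0# <ᵣ 1#
  0<1 with <-cmp 0# 1#
  ... | B.tri< h _ _ = h
  ... | B.tri≈ _ h _ = contradiction h 0≢1
  -- If 1 were negative, it would still be the square of the positive number -1.
  ... | B.tri> _ _ h = subst (0# <ᵣ_) square (*-pos _ _ (x<0⇒0<-x h) (x<0⇒0<-x h))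
    where
    square : (- 1#) *ᵣ (- 1#) ≡ 1#
    square = trans (sym (-‿distribˡ-* 1# (- 1#))) (trans (cong -_ (*-identityˡ (- 1#))) (-‿involutive 1#))

  pos⇒x<y+x : ∀ {y} x → 0# <ᵣ y → x <ᵣ y +ᵣ x
  pos⇒x<y+x {y} x 0<y = subst (_<ᵣ y +ᵣ x) (+-identityˡ x) (+-mono-< 0# y x 0<y)

  -1+x<x : ∀ x → (- 1#) +ᵣ x <ᵣ x
  -1+x<x x = subst ((- 1#) +ᵣ x <ᵣ_) (trans (sym (+-assoc 1# (- 1#) x)) (trans (cong (_+ᵣ x) (-‿inverseʳ 1#)) (+-identityˡ x)))
    (pos⇒x<y+x ((- 1#) +ᵣ x) 0<1)

  half : ∃ λ h → 0# <ᵣ h × h +ᵣ h ≡ 1#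
  half with inverse (1# +ᵣ 1#) (λ 2≡0 → <-irrefl (sym 2≡0) (<-trans 0<1 (pos⇒x<y+x 1# 0<1)))
  ... | h , 2h≡1 = h , positive , h+h≡1
    where
    h+h≡1 : h +ᵣ h ≡ 1#
    h+h≡1 = trans (sym (trans (distribʳ h 1# 1#) (cong₂ _+ᵣ_ (*-identityˡ h) (*-identityˡ h)))) 2h≡1
    positive : 0# <ᵣ h
    positive with <-cmp 0# h
    ... | B.tri< p _ _ = p
    ... | B.tri≈ _ refl _ = contradiction (trans (sym (+-identityˡ 0#)) h+h≡1) 0≢1
    ... | B.tri> _ _ h<0 = contradiction 0<1 (<-asym (<-trans
      (subst (_<ᵣ h) h+h≡1 (subst (h +ᵣ h <ᵣ_) (+-identityˡ h) (+-mono-< h 0# h h<0)))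
      h<0))

  -- The midpoint, with `e` half of the distance.
  dense : ∀ {x y} → x <ᵣ y → ∃ λ z → x <ᵣ z × z <ᵣ y
  dense {x} {y} x<y with h , 0<h , h+h≡1 ← half =
    e +ᵣ x , pos⇒x<y+x x 0<e , subst (e +ᵣ x <ᵣ_) total (pos⇒x<y+x (e +ᵣ x) 0<e)
    where
    e : ℝ
    e = (y - x) *ᵣ h
    0<e : 0# <ᵣ e
    0<e = *-pos _ _ (subst (_<ᵣ y - x) (-‿inverseʳ x) (+-mono-< x y (- x) x<y)) 0<h
    total : e +ᵣ (e +ᵣ x) ≡ y
    total = begin
      e +ᵣ (e +ᵣ x)          ≡⟨ sym (+-assoc e e x) ⟩
      (e +ᵣ e) +ᵣ x          ≡⟨ cong (_+ᵣ x) (sym (distribˡ (y - x) h h)) ⟩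
      (y - x) *ᵣ (h +ᵣ h) +ᵣ x ≡⟨ cong (λ k → (y - x) *ᵣ k +ᵣ x) h+h≡1 ⟩
      (y - x) *ᵣ 1# +ᵣ x     ≡⟨ cong (_+ᵣ x) (*-identityʳ (y - x)) ⟩
      (y - x) +ᵣ x          ≡⟨ +-assoc y (- x) x ⟩
      y +ᵣ (- x +ᵣ x)        ≡⟨ cong (y +ᵣ_) (-‿inverseˡ x) ⟩
      y +ᵣ 0#               ≡⟨ +-identityʳ y ⟩
      y                    ∎
      where open ≡-Reasoning

  -- (x , false) and (x , true) are the cuts of ℝ immediately before and after x.
  finiteCuts : StrictTotalOrder 0ℓ 0ℓ 0ℓ
  finiteCuts = ×-strictTotalOrder ℝ-strictTotalOrder Boolₚ.<-strictTotalOrder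

  cuts : StrictTotalOrder 0ℓ 0ℓ 0ℓ
  cuts = record { isStrictTotalOrder =
    Extrema.<±-isStrictTotalOrder (StrictTotalOrder._<_ finiteCuts) (StrictTotalOrder.isStrictTotalOrder finiteCuts) }

  open Extrema (StrictTotalOrder._<_ finiteCuts) using ([_]; ⊥±<[_]; [_]<⊤±; ⊥±<⊤±)
  open Intervals cuts

  -- A closed left end is the cut before its point, a closed right end the cut after it; hence the
  -- negation on the left only.
  lower upper : Interval R → Cut
  lower whole               = ⊥±
  lower (bounded (a , c) _) = [ a , not c ]
  upper whole               = ⊤±
  upper (bounded _ (b , c)) = [ b , c ]

  before after : ℝ → Cut
  before x = [ x , false ]
  after x  = [ x , true ]

  ∈I⇒cuts : ∀ {x} I → _∈I_ R x I → lower I ≺ after x × before x ≺ upper I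
  ∈I⇒cuts whole _ = ⊥±<[ _ ] , [ _ ]<⊤±
  ∈I⇒cuts (bounded lo hi) (p , q) = left lo p , right hi q
    where
    left : ∀ {x} lo → above R lo x → [ proj₁ lo , not (proj₂ lo) ] ≺ after x
    left {x} (a , true) a≤x with <-cmp a x
    ... | B.tri< h _ _ = [ inj₁ h ]
    ... | B.tri≈ _ h _ = [ inj₂ (h , f<t) ]
    ... | B.tri> _ _ h = contradiction h a≤x
    left (a , false) a<x = [ inj₁ a<x ]
    right : ∀ {x} hi → below R hi x → before x ≺ [ hi ]
    right {x} (b , true) x≤b with <-cmp x b
    ... | B.tri< h _ _ = [ inj₁ h ]
    ... | B.tri≈ _ h _ = [ inj₂ (h , f<t) ]
    ... | B.tri> _ _ h = contradiction h x≤b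
    right (b , false) x<b = [ inj₁ x<b ]

  cuts⇒∈I : ∀ {x} I → lower I ≺ after x → before x ≺ upper I → _∈I_ R x I
  cuts⇒∈I whole _ _ = tt
  cuts⇒∈I (bounded lo hi) p q = left lo p , right hi q
    where
    left : ∀ {x} lo → [ proj₁ lo , not (proj₂ lo) ] ≺ after x → above R lo x
    left (a , true) [ inj₁ h ]           = <-asym h
    left (a , true) [ inj₂ (h , _) ]     = <-irrefl (sym h)
    left (a , false) [ inj₁ h ]          = h
    left (a , false) [ inj₂ (_ , ()) ]
    right : ∀ {x} hi → before x ≺ [ hi ] → below R hi x
    right (b , true) [ inj₁ h ]          = <-asym h
    right (b , true) [ inj₂ (h , _) ]    = <-irrefl (sym h)
    right (b , false) [ inj₁ h ]         = h
    right (b , false) [ inj₂ (_ , ()) ]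

  -- Next to an infinite cut a step of length 1 suffices, and distinct reals have a midpoint. The
  -- last case is the singleton between the two cuts at `a`.
  between : ∀ {l r} → l ≺ r → ∃ λ x → l ≺ after x × before x ≺ r
  between {r = [ b , _ ]} ⊥±<[ _ ] = (- 1#) +ᵣ b , ⊥±<[ _ ] , [ inj₁ (-1+x<x b) ]
  between ⊥±<⊤± = 0# , ⊥±<[ _ ] , [ _ ]<⊤±
  between {l = [ a , _ ]} [ _ ]<⊤± = 1# +ᵣ a , [ inj₁ (pos⇒x<y+x a 0<1) ] , [ _ ]<⊤±
  between [ inj₁ a<b ] with x , a<x , x<b ← dense a<b = x , [ inj₁ a<x ] , [ inj₁ x<b ]
  between {l = [ a , _ ]} [ inj₂ (refl , f<t) ] = a , [ inj₂ (refl , f<t) ] , [ inj₂ (refl , f<t) ]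

  before≺⇒after≼ : ∀ {x l} → before x ≺ l → ¬ (l ≺ after x)
  before≺⇒after≼ [ inj₁ x<a ] [ inj₁ a<x ] = <-asym x<a a<x
  before≺⇒after≼ [ inj₁ x<a ] [ inj₂ (a≡x , _) ] = <-irrefl (sym a≡x) x<a
  before≺⇒after≼ [ inj₂ (x≡a , _) ] [ inj₁ a<x ] = <-irrefl (sym x≡a) a<x
  before≺⇒after≼ [ inj₂ (_ , f<t) ] [ inj₂ (_ , ()) ]

  straddle : ∀ {x l r} → l ≺ after x → before x ≺ r → l ≺ r
  straddle {x} {l} p q = ≼-≺-trans {l} {before x} (λ h → before≺⇒after≼ h p) q

  Nonempty : Interval R → Set
  Nonempty I = lower I ≺ upper I

  Overlap : Interval R → Interval R → Set
  Overlap I J = lower I ≺ upper J × lower J ≺ upper I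

  meet⇒overlap : ∀ {x} I J → _∈I_ R x I → _∈I_ R x J → Overlap I J
  meet⇒overlap I J p q with a , b ← ∈I⇒cuts I p | c , d ← ∈I⇒cuts J q = straddle a d , straddle c b

  member⇒nonempty : ∀ {x} I → _∈I_ R x I → Nonempty I
  member⇒nonempty I p = proj₁ (meet⇒overlap I I p p)

  -- A point between the larger of `k`, `l` and the smaller of `r`, `s`.
  between₂ : ∀ {k l r s} → k ≺ r → k ≺ s → l ≺ r → l ≺ s →
    ∃ λ x → (k ≺ after x × l ≺ after x) × (before x ≺ r × before x ≺ s)
  between₂ {k} {l} {r} {s} kr ks lr ls with k ≺? l | r ≺? s
  ... | yes k≺l | yes r≺s with x , p , q ← between lr = x , (≺-trans k≺l p , p) , q , ≺-trans q r≺s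
  ... | yes k≺l | no s≼r  with x , p , q ← between ls = x , (≺-trans k≺l p , p) , ≺-≼-trans q s≼r , q
  ... | no l≼k  | yes r≺s with x , p , q ← between kr = x , (p , ≼-≺-trans l≼k p) , q , ≺-trans q r≺s
  ... | no l≼k  | no s≼r  with x , p , q ← between ks = x , (p , ≼-≺-trans l≼k p) , ≺-≼-trans q s≼r , q

  overlap⇒meet : ∀ I J → Nonempty I → Nonempty J → Overlap I J → ∃ λ x → _∈I_ R x I × _∈I_ R x J
  overlap⇒meet I J i j (p , q) with x , (kx , lx) , xr , xs ← between₂ i p q j = x , cuts⇒∈I I kx xr , cuts⇒∈I J lx xs

  whole-maximal : ∀ I → isLocal R I ≢ true → ∀ J → ¬ (lower J ≺ lower I) × ¬ (upper I ≺ upper J)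
  whole-maximal whole         _       J = nothing-below (lower J) , λ ()
    where
    nothing-below : ∀ c → ¬ (c ≺ ⊥±)
    nothing-below ⊥±    h = ≺-irrefl Eq.refl h
    nothing-below [ _ ] h = ≺-asym h ⊥±<[ _ ]
    nothing-below ⊤±    ()
  whole-maximal (bounded _ _) unlocal J = contradiction refl unlocal

  -- The cut model presupposes nonempty intervals. A vertex whose box is empty in some dimension is
  -- isolated, so it is removed by induction and may receive any colour.
  colouring : ∀ n (G : Graph n) → TriangleFree G → ∀ {d} (B : Fin n → Box R (suc d)) → (∀ v → localCount R (B v) ≤ 2) →
    (∀ u v → u ≢ v → Adj G u v ⇔ boxesIntersect R (B u) (B v)) → Colourable G 18
  colouring zero G tf B few rep = (λ ()) , λ ()
  colouring (suc n) G tf {d} B few rep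
    with Finₚ.any? (λ v → Finₚ.any? λ i → ¬? (lower (B v i) ≺? upper (B v i)))
  ... | yes (v , i , empty)
    with c , proper ← colouring n (record
           { Adj = λ x y → Adj G (punchIn v x) (punchIn v y) ; sym = Graph.sym G ; irrefl = irrefl G })
           (λ x y z → tf _ _ _) (B ∘ punchIn v) (few ∘ punchIn v)
           (λ x y x≢y → rep _ _ (x≢y ∘ Finₚ.punchIn-injective v x y))
    = insertAt c v zero , insert-colouring {E = Adj G} (Graph.sym G) (irrefl G) v c zero proper isolated
    where
    isolated : ∀ x → Adj G v (punchIn v x) → c x ≢ zero
    isolated x adj _ with points , inside ← Equivalence.to (rep v (punchIn v x) (Finₚ.punchInᵢ≢i v x ∘ sym)) adj =
      empty (member⇒nonempty (B v i) (proj₁ (inside i)))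
  ... | no allNonempty = proj₁ coloured , λ u v uv → proj₂ coloured u v (to-cuts uv)
    where
    nonempty : ∀ v i → Nonempty (B v i)
    nonempty v i = decidable-stable (lower (B v i) ≺? upper (B v i)) λ empty → allNonempty (v , i , empty)
    L U : Fin (suc n) → Fin (suc d) → Cut
    L v i = lower (B v i)
    U v i = upper (B v i)
    module Cuts = Boxes L U
    to-cuts : ∀ {u v} → Adj G u v → Cuts.Adjacent u v
    to-cuts {u} {v} uv = u≢v , λ i → meet⇒overlap (B u i) (B v i) (proj₁ (inside i)) (proj₂ (inside i))
      where
      u≢v : u ≢ v
      u≢v refl = irrefl G uv
      inside = proj₂ (Equivalence.to (rep u v u≢v) uv)
    from-cuts : ∀ {u v} → Cuts.Adjacent u v → Adj G u v
    from-cuts {u} {v} (u≢v , ov) = Equivalence.from (rep u v u≢v) ((proj₁ ∘ meet) , (proj₂ ∘ meet))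
      where
      meet : ∀ i → ∃ λ x → _∈I_ R x (B u i) × _∈I_ R x (B v i)
      meet i = overlap⇒meet (B u i) (B v i) (nonempty u i) (nonempty v i) (ov i)
    axes : ∀ v → ∃₂ λ a b → a Fin.≤ b × (∀ i → isLocal R (B v i) ≡ true → i ≡ a ⊎ i ≡ b)
    axes v = local-axes R (B v) (few v)
    unbounded : ∀ v i → i ≢ proj₁ (axes v) → i ≢ proj₁ (proj₂ (axes v)) → ∀ w → ¬ (L w i ≺ L v i) × ¬ (U v i ≺ U w i)
    unbounded v i i≢a i≢b w = whole-maximal (B v i) (λ loc → [ i≢a , i≢b ]′ (proj₂ (proj₂ (proj₂ (axes v))) i loc)) (B w i)
    coloured = Cuts.Local.18-colouring
      (λ v → proj₁ (axes v)) (λ v → proj₁ (proj₂ (axes v))) (λ v → proj₁ (proj₂ (proj₂ (axes v))))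
      nonempty unbounded (λ uv vw uw → tf _ _ _ (from-cuts uv , from-cuts vw , from-cuts uw))

theorem1p8 : (R : RealLine) → (n : ℕ) → (G : Graph n) →
    TriangleFree G → LboxAtMost R G 2 → Colourable G 18
-- The bound `1 ≤ d'` leaves only a successor, which provides the default dimension for padding.
theorem1p8 R n G tf (d , d≤2 , suc d' , _ , _ , B , few , rep) =
  Line.colouring R n G tf B (λ v → ℕₚ.≤-trans (few v) d≤2) rep
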